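{- Let $\mathcal{G}=(V,E,\lambda)$ be a happy compressed temporal graph with $n=|V|$ vertices. If $\mathcal{G}$ is acyclic and temporally connected, then $n$ is even.
   Context: A happy temporal graph is a triple $\mathcal{G}=(V,E,\lambda)$ where $(V,E)$ is a finite simple undirected graph (the footprint) and $\lambda:E\to\{1,2,3,\dots\}$ assigns a single time label to each edge, such that two distinct edges sharing an endpoint have different labels. It is compressed if for every edge $e$ with $\lambda(e)>1$ there is an edge $e'$ adjacent to $e$ with $\lambda(e')=\lambda(e)-1$. A temporal walk is a walk in the footprint along which edge labels are strictly increasing (so no edge is repeated). $\mathcal{G}$ is temporally connected if all the vertices can reach each other through temporal walks, i.e. for all distinct $u,v\in V$ there is a temporal walk from $u$ to $v$. A temporal cycle is a nonempty temporal walk from a vertex to itself; $\mathcal{G}$ is acyclic if it has no temporal cycle.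
   Formalization: The case n = 1 is excluded: the single vertex without edges is vacuously happy, compressed, acyclic and temporally connected, but 1 is odd, so the statement is false there. -}

module Defs where

open import Data.Fin.Base using (Fin)
open import Data.List.Base using (List; []; _∷_)
open import Data.List.Relation.Unary.Linked using (Linked)
open import Data.Nat.Base using (ℕ; _≤_; _<_; _∸_)
open import Data.Product.Base using (∃; ∃-syntax; ∃₂; _×_; _,_)
open import Data.Sum.Base using (_⊎_)
open import Level using (0ℓ)
open import Relation.Binary.Construct.Closure.ReflexiveTransitive using (Star; ε; _◅_)
open import Relation.Binary.Core using (Rel)
open import Relation.Binary.Definitions using (Decidable; Irreflexive; Symmetric)
open import Relation.Binary.PropositionalEquality.Core using (_≡_; _≢_)
open import Relation.Nullary.Negation.Core using (¬_)

record SimpleGraph (n : ℕ) : Set₁ where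
  infix 4 _~_ _∈ₑ_ _≈ₑ_
  field
    _~_      : Rel (Fin n) 0ℓ
    ~-dec    : Decidable _~_
    ~-irrefl : Irreflexive _≡_ _~_
    ~-sym    : Symmetric _~_

  -- An undirected edge is represented by either of its two orientations
  -- together with any proof of adjacency; _≈ₑ_ identifies all of these.
  Edge : Set
  Edge = ∃₂ _~_

  _∈ₑ_ : Fin n → Edge → Set
  x ∈ₑ (u , v , _) = x ≡ u ⊎ x ≡ v

  _≈ₑ_ : Rel Edge 0ℓ
  (u , v , _) ≈ₑ (u′ , v′ , _) = (u ≡ u′ × v ≡ v′) ⊎ (u ≡ v′ × v ≡ u′)

  Adjacent : Rel Edge 0ℓ
  Adjacent e f = ¬ (e ≈ₑ f) × ∃[ x ] (x ∈ₑ e × x ∈ₑ f)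

  Walk : Rel (Fin n) 0ℓ
  Walk = Star _~_

record HappyTemporalGraph (n : ℕ) : Set₁ where
  field
    footprint : SimpleGraph n

  open SimpleGraph footprint public

  field
    label       : Edge → ℕ
    label-cong  : ∀ {e f} → e ≈ₑ f → label e ≡ label f
    label-pos   : ∀ e → 1 ≤ label e
    label-happy : ∀ {e f} → Adjacent e f → label e ≢ label f

  Compressed : Set
  Compressed = ∀ e → 1 < label e → ∃[ f ] (Adjacent e f × label f ≡ label e ∸ 1)

  labels : ∀ {u v} → Walk u v → List ℕ
  labels ε       = []
  labels (p ◅ w) = label (_ , _ , p) ∷ labels w

  Temporal : ∀ {u v} → Walk u v → Set
  Temporal w = Linked _<_ (labels w)

  TemporallyConnected : Set
  TemporallyConnected = ∀ u v → u ≢ v → ∃ λ (w : Walk u v) → Temporal w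

  TemporalCycle : Set
  TemporalCycle = ∃[ v ] ∃ λ (w : Walk v v) → w ≢ ε × Temporal w

  Acyclic : Set
  Acyclic = ¬ TemporalCycle

{-# OPTIONS --safe #-}

-- At every vertex v let vw be the incident edge of smallest label. It is also
-- the edge of smallest label at w: if wx had a smaller label, take a temporal
-- walk from v to x. If it starts with vw, replace this step by xw; otherwise
-- put xwv in front of it. Either way a temporal cycle through x arises.
-- Hence the earliest edges form a perfect matching.
module Submission where

open import Defs
open import Data.Bool.Base using (if_then_else_)
open import Data.Fin.Base using (Fin; zero; punchIn)
open import Data.Fin.Permutation using (permutation)
open import Data.Fin.Properties using (_≟_; _<?_; any?; punchInᵢ≢i; <-asym; ≤-antisym)
open import Data.List.Base using (_∷_)
open import Data.List.Relation.Unary.Linked using (Linked; [-]; _∷_)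
open import Data.Nat.Base as ℕ using (ℕ; suc; _≤_; _<_; _+_; _*_)
open import Data.Nat.Divisibility.Core using (_∣_; divides)
open import Data.Nat.Induction using (<-rec)
import Data.Nat.Properties as ℕₚ
open import Data.Product.Base using (∃; ∃-syntax; Σ-syntax; _,_; proj₁; proj₂)
open import Data.Sum.Base using (inj₁; inj₂)
open import Function.Base using (_∘_)
open import Relation.Binary.Construct.Closure.ReflexiveTransitive using (ε; _◅_)
open import Relation.Binary.PropositionalEquality
  using (_≡_; _≢_; refl; sym; trans; cong; subst; module ≡-Reasoning)
open import Relation.Nullary using (¬_; Dec; yes; no; does; contradiction)
open import Relation.Nullary.Decidable using (map′)

open import Algebra.Properties.CommutativeMonoid.Sum ℕₚ.+-0-commutativeMonoid
  using (sum-syntax; ∑-distrib-+; ∑-permute; sum-cong-≗)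

∑1≡n : ∀ n → ∑[ i < n ] 1 ≡ n
∑1≡n ℕ.zero  = refl
∑1≡n (suc n) = cong suc (∑1≡n n)

indicator : ∀ {A : Set} → Dec A → ℕ
indicator a? = if does a? then 1 else 0

exactlyOne : ∀ {A B : Set} (a? : Dec A) (b? : Dec B) →
             (A → ¬ B) → (¬ A → ¬ ¬ B) → indicator a? + indicator b? ≡ 1
exactlyOne (yes a) (yes b) a→¬b _   = contradiction b (a→¬b a)
exactlyOne (yes _) (no  _) _    _   = refl
exactlyOne (no  _) (yes _) _    _   = refl
exactlyOne (no ¬a) (no ¬b) _    ¬¬b = contradiction ¬b (¬¬b ¬a)

module _ {n} (f : Fin n → Fin n) (f-invol : ∀ i → f (f i) ≡ i) (f-free : ∀ i → f i ≢ i) where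

  private
    χ : Fin n → ℕ
    χ i = indicator (i <? f i)

    χ+χ∘f≡1 : ∀ i → χ i + χ (f i) ≡ 1
    χ+χ∘f≡1 i rewrite f-invol i = exactlyOne (i <? f i) (f i <? i) <-asym
      λ i≮fi fi≮i → f-free i (≤-antisym (ℕₚ.≮⇒≥ i≮fi) (ℕₚ.≮⇒≥ fi≮i))

  -- `χ` marks the smaller element of each orbit of `f`. Exactly one of `i` and `f i` is marked, so
  -- summing `χ i + χ (f i)` counts every index once; reindexing along the permutation `f` shows
  -- that both halves of the sum agree.
  fixedPointFreeInvolution⇒even : 2 ∣ n
  fixedPointFreeInvolution⇒even = divides Σχ (begin
    n                             ≡⟨ ∑1≡n n ⟨
    ∑[ i < n ] 1                  ≡⟨ sum-cong-≗ χ+χ∘f≡1 ⟨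
    ∑[ i < n ] (χ i + χ (f i))    ≡⟨ ∑-distrib-+ χ (χ ∘ f) ⟩
    Σχ + ∑[ i < n ] χ (f i)       ≡⟨ cong (Σχ +_) (∑-permute χ (permutation f f f-invol f-invol)) ⟨
    Σχ + Σχ                       ≡⟨ cong (Σχ +_) (ℕₚ.+-identityʳ Σχ) ⟨
    2 * Σχ                        ≡⟨ ℕₚ.*-comm 2 Σχ ⟩
    Σχ * 2                        ∎)
    where
    open ≡-Reasoning
    Σχ = ∑[ i < n ] χ i

another : ∀ {n} → n ≢ 1 → (v : Fin n) → ∃[ u ] u ≢ v
another {1}           n≢1 _ = contradiction refl n≢1
another {suc (suc n)} _   v = punchIn v zero , punchInᵢ≢i v zero

lower-head : ∀ {a b xs} → a ≤ b → Linked _<_ (b ∷ xs) → Linked _<_ (a ∷ xs)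
lower-head a≤b [-]         = [-]
lower-head a≤b (b<c ∷ inc) = ℕₚ.≤-<-trans a≤b b<c ∷ inc

module _ {n} (G : HappyTemporalGraph n) where
  open HappyTemporalGraph G

  private
    ℓ : ∀ {u v} → u ~ v → ℕ
    ℓ p = label (_ , _ , p)

  label-irrelevant : ∀ {u v} (p q : u ~ v) → ℓ p ≡ ℓ q
  label-irrelevant p q = label-cong (inj₁ (refl , refl))

  label-sym : ∀ {u v} (p : u ~ v) (q : v ~ u) → ℓ p ≡ ℓ q
  label-sym p q = label-cong (inj₂ (refl , refl))

  -- Happiness in contrapositive form: if `w` and `x` differ, the two edges are distinct in either
  -- orientation, yet they share `v`.
  label-injective : ∀ {v w x} (p : v ~ w) (q : v ~ x) → ℓ p ≡ ℓ q → w ≡ x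
  label-injective {v} {w} {x} p q eq with w ≟ x
  ... | yes w≡x = w≡x
  ... | no  w≢x = contradiction eq (label-happy (distinct , v , inj₁ refl , inj₁ refl))
    where
    distinct : ¬ ((v , w , p) ≈ₑ (v , x , q))
    distinct (inj₁ (_ , w≡x))   = w≢x w≡x
    distinct (inj₂ (v≡x , w≡v)) = w≢x (trans w≡v v≡x)

  Earliest : ∀ {v w} → v ~ w → Set
  Earliest {v} p = ∀ {x} (q : v ~ x) → ℓ p ≤ ℓ q

  earlier? : ∀ v l → Dec (∃[ x ] Σ[ q ∈ v ~ x ] ℓ q < l)
  earlier? v l = any? earlierTo?
    where
    earlierTo? : ∀ x → Dec (Σ[ q ∈ v ~ x ] ℓ q < l)
    earlierTo? x with ~-dec v x
    ... | no  v≁x = no (v≁x ∘ proj₁)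
    ... | yes q   = map′ (q ,_)
      -- The label does not depend on the adjacency proof, so testing the one supplied by `~-dec`
      -- settles the question for all of them.
      (λ (q′ , lt) → subst (_< l) (label-irrelevant q′ q) lt)
      (ℓ q ℕₚ.<? l)

  -- Descent on the label: move to an earlier edge at `v` as long as there is one.
  earliest : ∀ {v w} → v ~ w → ∃[ x ] Σ[ p ∈ v ~ x ] Earliest p
  earliest {v} p₀ = <-rec P step _ p₀ refl
    where
    P : ℕ → Set
    P l = ∀ {w} (p : v ~ w) → ℓ p ≡ l → ∃[ x ] Σ[ q ∈ v ~ x ] Earliest q

    step : ∀ l → (∀ {k} → k < l → P k) → P l
    step l rec p refl with earlier? v l
    ... | yes (_ , q , q<p) = rec q<p q refl
    ... | no  none          = _ , p , λ q → ℕₚ.≮⇒≥ λ q<p → none (_ , q , q<p)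

  earliest-unique : ∀ {v w x} {p : v ~ w} {q : v ~ x} → Earliest p → Earliest q → w ≡ x
  earliest-unique {p = p} {q} p-min q-min =
    label-injective p q (ℕₚ.≤-antisym (p-min q) (q-min p))

  -- Provides the edge from which the search for the earliest one starts: the first step of a walk
  -- to any other vertex.
  neighbour : TemporallyConnected → n ≢ 1 → ∀ v → ∃[ w ] v ~ w
  neighbour connected n≢1 v with another n≢1 v
  ... | u , u≢v with connected v u (u≢v ∘ sym)
  ...   | ε     , _ = contradiction refl u≢v
  ...   | p ◅ _ , _ = _ , p

  module _ (acyclic : Acyclic) (connected : TemporallyConnected) where

    earliest-sym : ∀ {v w} (p : v ~ w) → Earliest p → Earliest (~-sym p)
    earliest-sym {v} {w} p p-min {x} q = ℕₚ.≮⇒≥ λ q<p⁻ →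
      let v≢x : v ≢ x
          -- If `x` were `v`, then `q` would be the reverse of `p` and could not have a smaller
          -- label.
          v≢x = λ { refl → ℕₚ.<⇒≢ q<p⁻ (label-irrelevant q (~-sym p)) }
      in closes (subst (_< ℓ (~-sym p)) (label-sym q (~-sym q)) q<p⁻) v≢x (connected v x v≢x)
      where
      closes : ℓ (~-sym q) < ℓ (~-sym p) → v ≢ x → ¬ ∃ λ (ws : Walk v x) → Temporal ws
      closes _     v≢x (ε , _) = v≢x refl
      closes q⁻<p⁻ _   (r ◅ ws , inc) with ℓ p ℕₚ.<? ℓ r
      ... | yes p<r = acyclic (x , ~-sym q ◅ ~-sym p ◅ r ◅ ws , (λ ()) ,
                        q⁻<p⁻ ∷ subst (_< ℓ r) (label-sym p (~-sym p)) p<r ∷ inc)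
      -- Minimality of `p` at `v` makes the labels of `p` and `r` equal, so `r` also leads to `w`,
      -- and `ws` can be entered from `x` through `w`.
      ... | no  p≮r with label-injective p r (ℕₚ.≤-antisym (p-min r) (ℕₚ.≮⇒≥ p≮r))
      ...   | refl = acyclic (x , ~-sym q ◅ ws , (λ ()) , lower-head q⁻≤r inc)
        where
        q⁻≤r : ℓ (~-sym q) ≤ ℓ r
        q⁻≤r = ℕₚ.<⇒≤ (subst (ℓ (~-sym q) <_) (label-sym (~-sym p) r) q⁻<p⁻)

lemma3p6 : (n : ℕ) → n ≢ 1 →
    (G : HappyTemporalGraph n) →
    let open HappyTemporalGraph G in
    Compressed → Acyclic → TemporallyConnected → 2 ∣ n
lemma3p6 n n≢1 G _ acyclic connected = fixedPointFreeInvolution⇒even partner partner-invol partner-free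
  where
  open HappyTemporalGraph G

  first : ∀ v → ∃[ w ] Σ[ p ∈ v ~ w ] Earliest G p
  first v = earliest G (proj₂ (neighbour G connected n≢1 v))

  partner : Fin n → Fin n
  partner = proj₁ ∘ first

  partner-invol : ∀ v → partner (partner v) ≡ v
  partner-invol v with first v
  -- Both the edge chosen at `w` and the reverse of `p` are earliest at `w`, hence they end at the
  -- same vertex.
  ... | w , p , p-min = earliest-unique G (proj₂ (proj₂ (first w)))
                          (earliest-sym G acyclic connected p p-min)

  partner-free : ∀ v → partner v ≢ v
  partner-free v eq with first v
  ... | w , p , _ = ~-irrefl (sym eq) p
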